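{- Let $D$ be a quiver with $V(D)\neq\emptyset$, and let $L(D)$ be its loading. Define $j_{D,V} : V(D)\to V(L(D))$ by $j_{D,V}(v)=v$ and $j_{D,E} : E(D)\to E(L(D))$ by $j_{D,E}(e)=(0,e)$. Then $j_D := (j_{D,V},j_{D,E})$ is a mono-essential quiver homomorphism, and $L(D)$ equipped with $j_D$ is a mono-injective envelope of $D$ in $\mathbf{Quiv}$.
   Context: A quiver is a quadruple $(V,E,\sigma,\tau)$ with $V,E$ sets and $\sigma,\tau : E \to V$ functions (source and target). A quiver homomorphism is a pair of functions on vertices and edges commuting with sources and targets; $\mathbf{Quiv}$ is the category of quivers and these homomorphisms. A homomorphism is monic iff its vertex and edge maps are both injective. For $v,w\in V(D)$, $\mathrm{edges}_D(v,w):=\sigma_D^{ -1}(v)\cap\tau_D^{ -1}(w)$. The loading $L(D)$ of $D$ has vertex set $V(D)$, edge set $\{(0,e): e\in E(D)\}\cup\{(1,v,w): v,w\in V(D),\ \mathrm{edges}_D(v,w)=\emptyset\}$, with source and target $\sigma(0,e)=\sigma_D(e)$, $\tau(0,e)=\tau_D(e)$, $\sigma(1,v,w)=v$, $\tau(1,v,w)=w$. A quiver $J$ is mono-injective if for every monic $\phi: A\to B$ and every $\psi: A\to J$ there exists $\hat\psi : B\to J$ with $\hat\psi\circ\phi=\psi$. A monic $\varphi : D\to C$ is mono-essential if for every quiver $A$ and homomorphism $\alpha: C\to A$, $\alpha\circ\varphi$ monic implies $\alpha$ monic. A mono-injective envelope of $D$ is a mono-injective quiver $C$ together with a mono-essential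 homomorphism $D\to C$. -}

module Defs where

open import Level using (Level; suc; Lift; lift; lower)
open import Data.Bool using (Bool; true; false)
open import Data.Product using (Σ-syntax; _×_; _,_; proj₁; proj₂)
open import Data.Empty using (⊥)
open import Data.Unit using (⊤)
open import Function using (id; _∘_; _⇔_; mk⇔)
open import Function.Definitions using (Injective)
open import Relation.Unary using (Pred; Empty; _⊢_; _∩_; ｛_｝)
open import Relation.Binary.PropositionalEquality
  using (_≡_; refl; sym; trans; cong)

private
  variable
    ℓ : Level

record Quiver (ℓ : Level) : Set (suc ℓ) where
  field
    V E : Set ℓ
    σ τ : E → V

open Quiver public

record IsHom (A B : Quiver ℓ) (fV : V A → V B) (fE : E A → E B) : Set ℓ where
  field
    σ-comm : ∀ e → σ B (fE e) ≡ fV (σ A e)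
    τ-comm : ∀ e → τ B (fE e) ≡ fV (τ A e)

open IsHom public

record Hom (A B : Quiver ℓ) : Set ℓ where
  constructor mkHom
  field
    vmap  : V A → V B
    emap  : E A → E B
    isHom : IsHom A B vmap emap

open Hom public

infixr 9 _∘ₕ_

_∘ₕ_ : {A B C : Quiver ℓ} → Hom B C → Hom A B → Hom A C
vmap  (g ∘ₕ f) = vmap g ∘ vmap f
emap  (g ∘ₕ f) = emap g ∘ emap f
isHom (g ∘ₕ f) = record
  { σ-comm = λ e → trans (σ-comm (isHom g) (emap f e)) (cong (vmap g) (σ-comm (isHom f) e))
  ; τ-comm = λ e → trans (τ-comm (isHom g) (emap f e)) (cong (vmap g) (τ-comm (isHom f) e))
  }

-- Equality of homomorphisms is pointwise equality of the vertex and edge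
-- maps, since function extensionality is not available.

infix 4 _≈ₕ_

_≈ₕ_ : {A B : Quiver ℓ} → Hom A B → Hom A B → Set ℓ
f ≈ₕ g = (∀ v → vmap f v ≡ vmap g v) × (∀ e → emap f e ≡ emap g e)

Monic : {A B : Quiver ℓ} → Hom A B → Set (suc ℓ)
Monic {ℓ} {A} φ = (X : Quiver ℓ) (f g : Hom X A) → φ ∘ₕ f ≈ₕ φ ∘ₕ g → f ≈ₕ g

monic⇔injective : {A B : Quiver ℓ} (φ : Hom A B) →
  Monic φ ⇔ (Injective _≡_ _≡_ (vmap φ) × Injective _≡_ _≡_ (emap φ))
monic⇔injective {ℓ} {A} {B} φ = mk⇔
  (λ m → (λ {v} {w} p → proj₁ (m point (pt v) (pt w) ((λ _ → p) , λ ())) _)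
       , (λ {e} {e′} p → proj₂ (m arrow (ar e) (ar e′) (ends p , λ _ → p)) _))
  (λ inj X f g p → (λ v → proj₁ inj (proj₁ p v)) , (λ e → proj₂ inj (proj₂ p e)))
  where
  point : Quiver ℓ
  point = record { V = Lift ℓ ⊤ ; E = Lift ℓ ⊥ ; σ = λ () ; τ = λ () }

  pt : V A → Hom point A
  pt v = mkHom (λ _ → v) (λ ()) record { σ-comm = λ () ; τ-comm = λ () }

  arrow : Quiver ℓ
  arrow = record { V = Lift ℓ Bool ; E = Lift ℓ ⊤
                 ; σ = λ _ → lift false ; τ = λ _ → lift true }

  end : E A → Lift ℓ Bool → V A
  end e (lift false) = σ A e
  end e (lift true)  = τ A e

  ar : E A → Hom arrow A
  ar e = mkHom (end e) (λ _ → e) record { σ-comm = λ _ → refl ; τ-comm = λ _ → refl }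

  ends : ∀ {e e′} → emap φ e ≡ emap φ e′ →
         ∀ b → vmap φ (end e b) ≡ vmap φ (end e′ b)
  ends p (lift false) = trans (sym (σ-comm (isHom φ) _)) (trans (cong (σ B) p) (σ-comm (isHom φ) _))
  ends p (lift true)  = trans (sym (τ-comm (isHom φ) _)) (trans (cong (τ B) p) (τ-comm (isHom φ) _))

edges : (D : Quiver ℓ) → V D → V D → Pred (E D) ℓ
edges D v w = (σ D ⊢ ｛ v ｝) ∩ (τ D ⊢ ｛ w ｝)

-- `old e` is (0 , e) and `new v w` is (1 , v , w).  The emptiness proof is
-- irrelevant, so there is at most one new edge from v to w.

data LoadingEdge (D : Quiver ℓ) : Set ℓ where
  old : E D → LoadingEdge D
  new : (v w : V D) → .(Empty (edges D v w)) → LoadingEdge D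

L : Quiver ℓ → Quiver ℓ
V (L D) = V D
E (L D) = LoadingEdge D
σ (L D) (old e)     = σ D e
σ (L D) (new v w _) = v
τ (L D) (old e)     = τ D e
τ (L D) (new v w _) = w

jV : (D : Quiver ℓ) → V D → V (L D)
jV D v = v

jE : (D : Quiver ℓ) → E D → E (L D)
jE D e = old e

MonoInjective : Quiver ℓ → Set (suc ℓ)
MonoInjective {ℓ} J =
  (A B : Quiver ℓ) (φ : Hom A B) → Monic φ → (ψ : Hom A J) →
  Σ[ ψ̂ ∈ Hom B J ] ψ̂ ∘ₕ φ ≈ₕ ψ

MonoEssential : {D C : Quiver ℓ} → Hom D C → Set (suc ℓ)
MonoEssential {ℓ} {D} {C} φ =
  Monic φ × ((A : Quiver ℓ) (α : Hom C A) → Monic (α ∘ₕ φ) → Monic α)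

IsMonoInjectiveEnvelope : (D C : Quiver ℓ) → Hom D C → Set (suc ℓ)
IsMonoInjectiveEnvelope D C φ = MonoInjective C × MonoEssential φ

{-# OPTIONS --safe #-}
-- A quiver with a vertex and with an edge between any two of its vertices is
-- mono-injective: extend the vertex map arbitrarily off the image, then send
-- each remaining edge to any edge between the images of its ends.  A loading
-- has this property.  The embedding into the loading is mono-essential because
-- it is bijective on vertices and a new edge is determined by its ends, which
-- no old edge shares.
module Submission where

open import Defs
open import Level using (Level)
open import Axiom.ExcludedMiddle using (ExcludedMiddle)
open import Data.Product using (Σ-syntax; ∃; _×_; _,_; proj₁; proj₂)
open import Data.Empty using (⊥-elim-irr)
open import Function using (id; _∘_; Equivalence)
open import Function.Definitions using (Injective)
open import Relation.Nullary using (¬_; yes; no; contradiction)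
open import Relation.Nullary.Decidable using (decidable-stable)
open import Relation.Unary using (Satisfiable)
open import Relation.Binary.PropositionalEquality
  using (_≡_; refl; sym; trans; cong)

private
  variable
    ℓ : Level

module _ (em : ExcludedMiddle ℓ) where

  -- Excluded middle decides whether `y` lies in the image of `f`; `d` fills in where it does not.
  -- The codomain is dependent so that edges can be extended over their prescribed ends.
  extend : {X Y : Set ℓ} {Z : Y → Set ℓ} (f : X → Y) → Injective _≡_ _≡_ f →
           (g : ∀ x → Z (f x)) → (∀ y → Z y) →
           Σ[ ĝ ∈ (∀ y → Z y) ] (∀ x → ĝ (f x) ≡ g x)
  extend {X} {Y} {Z} f inj g d = ĝ , ĝ-extends
    where
    ĝ : ∀ y → Z y
    ĝ y with em {Σ[ x ∈ X ] f x ≡ y}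
    ... | yes (x , refl) = g x
    ... | no  _          = d y

    ĝ-extends : ∀ x → ĝ (f x) ≡ g x
    ĝ-extends x with em {Σ[ x′ ∈ X ] f x′ ≡ f x}
    ... | no  ∄         = contradiction (x , refl) ∄
    -- The preimage found need not be `x` on the nose. Injectivity identifies the two, leaving `eq`
    -- a loop that K reduces to `refl`, so `ĝ` computes.
    ... | yes (x′ , eq) with inj eq | eq
    ...   | refl | refl = refl

  hasAllEdges⇒monoInjective : (J : Quiver ℓ) → V J →
    (∀ v w → Satisfiable (edges J v w)) → MonoInjective J
  hasAllEdges⇒monoInjective J v₀ edge A B φ monic ψ =
    mkHom v̂ (proj₁ ∘ ê)
      record { σ-comm = λ e → sym (proj₁ (proj₂ (ê e)))
             ; τ-comm = λ e → sym (proj₂ (proj₂ (ê e))) }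
    , v̂-extends , cong proj₁ ∘ ê-extends
    where
    injective = Equivalence.to (monic⇔injective φ) monic

    vExt = extend (vmap φ) (proj₁ injective) (vmap ψ) (λ _ → v₀)
    v̂ = proj₁ vExt
    v̂-extends = proj₂ vExt

    -- Carrying the ends along in the type makes the extension a homomorphism.
    EdgeOver : E B → Set _
    EdgeOver b = ∃ (edges J (v̂ (σ B b)) (v̂ (τ B b)))

    ψ-over : ∀ e → EdgeOver (emap φ e)
    ψ-over e = emap ψ e
      , trans (cong v̂ (σ-comm (isHom φ) e))
              (trans (v̂-extends (σ A e)) (sym (σ-comm (isHom ψ) e)))
      , trans (cong v̂ (τ-comm (isHom φ) e))
              (trans (v̂-extends (τ A e)) (sym (τ-comm (isHom ψ) e)))

    eExt = extend {Z = EdgeOver} (emap φ) (proj₂ injective) ψ-over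
             (λ b → edge (v̂ (σ B b)) (v̂ (τ B b)))
    ê = proj₁ eExt
    ê-extends = proj₂ eExt

  L-hasAllEdges : (D : Quiver ℓ) → ∀ v w → Satisfiable (edges (L D) v w)
  L-hasAllEdges D v w with em {Satisfiable (edges D v w)}
  ... | yes (e , p , q) = old e , p , q
  ... | no  ∄           = new v w (λ e e∈ → ∄ (e , e∈)) , refl , refl

j-isHom : (D : Quiver ℓ) → IsHom D (L D) (jV D) (jE D)
j-isHom D = record { σ-comm = λ _ → refl ; τ-comm = λ _ → refl }

j : (D : Quiver ℓ) → Hom D (L D)
j D = mkHom (jV D) (jE D) (j-isHom D)

j-monic : (D : Quiver ℓ) → Monic (j D)
j-monic D = Equivalence.from (monic⇔injective (j D)) (id , λ { refl → refl })

module _ {A B : Quiver ℓ} (α : Hom A B) (vInj : Injective _≡_ _≡_ (vmap α)) where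

  σ-reflects : ∀ {e e′} → emap α e ≡ emap α e′ → σ A e ≡ σ A e′
  σ-reflects p = vInj (trans (sym (σ-comm (isHom α) _))
                             (trans (cong (σ B) p) (σ-comm (isHom α) _)))

  τ-reflects : ∀ {e e′} → emap α e ≡ emap α e′ → τ A e ≡ τ A e′
  τ-reflects p = vInj (trans (sym (τ-comm (isHom α) _))
                             (trans (cong (τ B) p) (τ-comm (isHom α) _)))

j-monoEssential : (D : Quiver ℓ) → MonoEssential (j D)
j-monoEssential D = j-monic D , λ A α monic →
  -- As `jV D` is the identity, injectivity of the composite on vertices is already that of `α`.
  α-monic α (Equivalence.to (monic⇔injective (α ∘ₕ j D)) monic)
  where
  α-monic : ∀ {A} (α : Hom (L D) A) →
            Injective _≡_ _≡_ (vmap α) × Injective _≡_ _≡_ (emap α ∘ old) →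
            Monic α
  α-monic α (vInj , oldInj) = Equivalence.from (monic⇔injective α) (vInj , eInj)
    where
    eInj : Injective _≡_ _≡_ (emap α)
    eInj {old e} {old e′} p = cong old (oldInj p)
    -- Here `e` would run from `v` to `w`, against `empty`. That proof is irrelevant, hence
    -- `⊥-elim-irr`.
    eInj {old e} {new v w empty} p =
      ⊥-elim-irr (empty e (sym (σ-reflects α vInj p) , sym (τ-reflects α vInj p)))
    eInj {new v w empty} {old e} p =
      ⊥-elim-irr (empty e (σ-reflects α vInj p , τ-reflects α vInj p))
    -- Once the ends agree, irrelevance of the emptiness proofs makes the two edges definitionally
    -- equal.
    eInj {new v w _} {new v′ w′ _} p with σ-reflects α vInj p | τ-reflects α vInj p
    ... | refl | refl = refl

mainTheorem5 : {ℓ : Level} → ExcludedMiddle ℓ →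
    (D : Quiver ℓ) → ¬ (¬ V D) →
    Σ[ h ∈ IsHom D (L D) (jV D) (jE D) ]
    (MonoEssential (mkHom (jV D) (jE D) h)
    × IsMonoInjectiveEnvelope D (L D) (mkHom (jV D) (jE D) h))
mainTheorem5 em D nonempty =
  j-isHom D , j-monoEssential D , L-monoInjective , j-monoEssential D
  where
  L-monoInjective : MonoInjective (L D)
  L-monoInjective =
    -- Excluded middle turns the doubly negated hypothesis into an actual vertex, the default value
    -- off the image.
    hasAllEdges⇒monoInjective em (L D) (decidable-stable em nonempty) (L-hasAllEdges em D)
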